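{- Let $\mathbb{A}$ be a symmetric strict monoidal category and let $\mathbf{H}\,\mathcal{C}(\mathbb{A})$ be the strict monoidal category of horizontal cells of its free cornering. Then $\mathbf{H}\,\mathcal{C}(\mathbb{A})$ is spatial; that is, for every object $X$ and every morphism $h:I\to I$ of $\mathbf{H}\,\mathcal{C}(\mathbb{A})$, $h\otimes 1_X=1_X\otimes h$.
   Context: Single-object double categories. A single-object double category $\mathbb{D}$ consists of a monoid $(\mathbb{D}_H,\otimes,I)$ of horizontal edges, a monoid $(\mathbb{D}_V,\otimes,I)$ of vertical edges, and cells $\alpha$, each with a top and a bottom boundary in $\mathbb{D}_H$ and a left and a right boundary in $\mathbb{D}_V$. If the right boundary of $\alpha$ equals the left boundary of $\beta$ there is a horizontal composite $\alpha\vert\beta$ (top/bottom boundaries are multiplied in the order $\alpha,\beta$; left boundary that of $\alpha$, right boundary that of $\beta$). If the bottom boundary of $\alpha$ equals the top boundary of $\beta$ there is a vertical composite $\frac{\alpha}{\beta}$ (left/right boundaries multiplied in the order $\alpha,\beta$; top that of $\alpha$, bottom that of $\beta$). Both compositions are associative and unital, with identity cells $1_A$ for $A\in\mathbb{D}_H$ (top $=$ bottom $=A$, left $=$ right $=I$; identities for vertical composition) and $1_X$ for $X\in\mathbb{D}_V$ (left $=$ right $=X$, top $=$ bottom $=I$; identities for horizontal composition), with $1_A\vert 1_B=1_{A\otimes B}$, $\frac{1_X}{1_Y}=1_{X\otimes Y}$, the two identity cells on $I$ coincide, and the interchange law $\frac{\alpha}{\beta}\big\vert\frac{\gamma}{\delta}=\frac{\alpha\vert\gamma}{\beta\vert\delta}$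 holds. Horizontal cells. $\mathbf{H}\mathbb{D}$ is the strict monoidal category with object set $\mathbb{D}_V$, whose morphisms $X\to Y$ are cells with left boundary $X$, right boundary $Y$ and top and bottom boundary $I$; composition is horizontal composition, and the tensor product is vertical composition, $h\otimes k=\frac{h}{k}$. Free cornering. For a symmetric strict monoidal category $\mathbb{A}$ (with object set $\mathbb{A}_0$), $\mathcal{C}(\mathbb{A})$ is the free single-object double category determined by: horizontal edge monoid $(\mathbb{A}_0,\otimes,I)$; vertical edge monoid the free monoid $\mathbb{A}^{\circ\bullet}=(\mathbb{A}_0\times\{\circ,\bullet\})^*$, with generators written $A^\circ$, $A^\bullet$, product written $\otimes$ and unit $I$; generating cells, for each $A\in\mathbb{A}_0$, the corners (boundaries not mentioned are $I$) - $s^\circ_A$: top $A$, right $A^\circ$; $\quad r^\circ_A$: left $A^\circ$, bottom $A$; - $s^\bullet_A$: top $A$, left $A^\bullet$; $\quad r^\bullet_A$: right $A^\bullet$, bottom $A$; and, for each morphism $f:A\to B$ of $\mathbb{A}$, a cell $\ulcorner f\urcorner$ with top $A$, bottom $B$; subject to the yanking equations $s^\circ_A\vert r^\circ_A=1_A$, $\frac{r^\circ_A}{s^\circ_A}=1_{A^\circ}$, $r^\bullet_A\vert s^\bullet_A=1_A$, $\frac{r^\bullet_A}{s^\bullet_A}=1_{A^\bullet}$, and the equations $\frac{\ulcorner f\urcorner}{\ulcorner g\urcorner}=\ulcorner f;g\urcorner$ (for composable $f,g$; $f;g$ is "first $f$ then $g$"), $\ulcorner 1_A\urcorner=1_A$,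 $\ulcorner f\urcorner\vert\ulcorner g\urcorner=\ulcorner f\otimes g\urcorner$. -}

module Defs where

open import Algebra.Structures using (IsMonoid)
open import Data.List.Base using (List; []; _++_; [_])
open import Data.List.Properties using (++-isMonoid)
open import Data.Product.Base using (_×_; _,_)
open import Level using (Level; suc; _⊔_)
open import Relation.Binary.PropositionalEquality.Core
  using (_≡_; refl; subst₂)
open import Relation.Binary.Structures using (IsEquivalence)

-- Strictness: objects form a monoid for _≡_.  Hom-sets are setoids, since the
-- hom-sets of the free cornering are quotients.  Laws whose two sides have
-- boundaries that agree only propositionally are stated by transporting one
-- side along the monoid laws; by K, such transports do not depend on the chosen
-- equality proofs.

record StrictMonoidalCategory (o ℓ e : Level) : Set (suc (o ⊔ ℓ ⊔ e)) where
  infix  4 _≈_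
  infixr 6 _⨾_
  infixr 7 _⊗₀_ _⊗₁_
  field
    Obj  : Set o
    Hom  : Obj → Obj → Set ℓ
    _≈_  : ∀ {A B} → Hom A B → Hom A B → Set e
    id   : ∀ A → Hom A A
    -- f ⨾ g is "first f then g"
    _⨾_  : ∀ {A B C} → Hom A B → Hom B C → Hom A C

    ≈-isEquivalence : ∀ {A B} → IsEquivalence (_≈_ {A} {B})
    ⨾-cong      : ∀ {A B C} {f f′ : Hom A B} {g g′ : Hom B C} →
                  f ≈ f′ → g ≈ g′ → f ⨾ g ≈ f′ ⨾ g′
    ⨾-assoc     : ∀ {A B C D} (f : Hom A B) (g : Hom B C) (h : Hom C D) →
                  (f ⨾ g) ⨾ h ≈ f ⨾ (g ⨾ h)
    ⨾-identityˡ : ∀ {A B} (f : Hom A B) → id A ⨾ f ≈ f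
    ⨾-identityʳ : ∀ {A B} (f : Hom A B) → f ⨾ id B ≈ f

    _⊗₀_ : Obj → Obj → Obj
    I    : Obj
    ⊗₀-isMonoid : IsMonoid _≡_ _⊗₀_ I

  open IsMonoid ⊗₀-isMonoid public
    using () renaming (assoc to ⊗₀-assoc; identityˡ to ⊗₀-identityˡ; identityʳ to ⊗₀-identityʳ)

  cast : ∀ {A A′ B B′} → A ≡ A′ → B ≡ B′ → Hom A B → Hom A′ B′
  cast = subst₂ Hom

  field
    _⊗₁_ : ∀ {A B C D} → Hom A B → Hom C D → Hom (A ⊗₀ C) (B ⊗₀ D)
    ⊗₁-cong : ∀ {A B C D} {f f′ : Hom A B} {g g′ : Hom C D} →
              f ≈ f′ → g ≈ g′ → f ⊗₁ g ≈ f′ ⊗₁ g′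
    ⊗₁-id   : ∀ A B → id A ⊗₁ id B ≈ id (A ⊗₀ B)
    ⊗₁-⨾    : ∀ {A B C A′ B′ C′}
              (f : Hom A B) (g : Hom B C) (f′ : Hom A′ B′) (g′ : Hom B′ C′) →
              (f ⨾ g) ⊗₁ (f′ ⨾ g′) ≈ (f ⊗₁ f′) ⨾ (g ⊗₁ g′)
    ⊗₁-assoc : ∀ {A A′ B B′ C C′} (f : Hom A A′) (g : Hom B B′) (h : Hom C C′) →
               cast (⊗₀-assoc A B C) (⊗₀-assoc A′ B′ C′) ((f ⊗₁ g) ⊗₁ h)
                 ≈ f ⊗₁ (g ⊗₁ h)
    ⊗₁-identityˡ : ∀ {A B} (f : Hom A B) →
                   cast (⊗₀-identityˡ A) (⊗₀-identityˡ B) (id I ⊗₁ f) ≈ f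
    ⊗₁-identityʳ : ∀ {A B} (f : Hom A B) →
                   cast (⊗₀-identityʳ A) (⊗₀-identityʳ B) (f ⊗₁ id I) ≈ f

Spatial : ∀ {o ℓ e} → StrictMonoidalCategory o ℓ e → Set (o ⊔ ℓ ⊔ e)
Spatial M = ∀ (X : Obj) (h : Hom I I) →
  cast (⊗₀-identityˡ X) (⊗₀-identityˡ X) (h ⊗₁ id X)
    ≈ cast (⊗₀-identityʳ X) (⊗₀-identityʳ X) (id X ⊗₁ h)
  where open StrictMonoidalCategory M

-- The unit coherence σ A I ≈ id and the second hexagon follow from the axioms
-- below.

record SymmetricStrictMonoidalCategory (o ℓ e : Level) : Set (suc (o ⊔ ℓ ⊔ e)) where
  field
    strictMonoidalCategory : StrictMonoidalCategory o ℓ e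

  open StrictMonoidalCategory strictMonoidalCategory public

  field
    σ : ∀ A B → Hom (A ⊗₀ B) (B ⊗₀ A)
    σ-natural    : ∀ {A A′ B B′} (f : Hom A A′) (g : Hom B B′) →
                   (f ⊗₁ g) ⨾ σ A′ B′ ≈ σ A B ⨾ (g ⊗₁ f)
    σ-involutive : ∀ A B → σ A B ⨾ σ B A ≈ id (A ⊗₀ B)
    σ-hexagon    : ∀ A B C →
                   cast refl (⊗₀-assoc B C A) (σ A (B ⊗₀ C))
                     ≈ cast (⊗₀-assoc A B C) (⊗₀-assoc B A C) (σ A B ⊗₁ id C)
                         ⨾ (id B ⊗₁ σ A C)

-- The boundaries of a cell are listed in the order top, bottom, left, right.

record SingleObjectDoubleCategory (o v c e : Level) : Set (suc (o ⊔ v ⊔ c ⊔ e)) where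
  infix  4 _≈_
  infixr 6 _∣_
  infixr 7 _/_
  infixr 8 _⊗ᴴ_ _⊗ⱽ_
  field
    H    : Set o
    _⊗ᴴ_ : H → H → H
    Iᴴ   : H
    H-isMonoid : IsMonoid _≡_ _⊗ᴴ_ Iᴴ

    V    : Set v
    _⊗ⱽ_ : V → V → V
    Iⱽ   : V
    V-isMonoid : IsMonoid _≡_ _⊗ⱽ_ Iⱽ

    Cell : (t b : H) (l r : V) → Set c
    _≈_  : ∀ {t b l r} → Cell t b l r → Cell t b l r → Set e
    ≈-isEquivalence : ∀ {t b l r} → IsEquivalence (_≈_ {t} {b} {l} {r})

  module H = IsMonoid H-isMonoid
  module V = IsMonoid V-isMonoid

  castᴴ : ∀ {t t′ b b′ l r} → t ≡ t′ → b ≡ b′ → Cell t b l r → Cell t′ b′ l r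
  castᴴ {l = l} {r} = subst₂ (λ t b → Cell t b l r)

  castⱽ : ∀ {t b l l′ r r′} → l ≡ l′ → r ≡ r′ → Cell t b l r → Cell t b l′ r′
  castⱽ {t} {b} = subst₂ (Cell t b)

  field
    _∣_ : ∀ {t t′ b b′ l m r} →
          Cell t b l m → Cell t′ b′ m r → Cell (t ⊗ᴴ t′) (b ⊗ᴴ b′) l r
    _/_ : ∀ {t m b l l′ r r′} →
          Cell t m l r → Cell m b l′ r′ → Cell t b (l ⊗ⱽ l′) (r ⊗ⱽ r′)
    1ᴴ  : ∀ A → Cell A A Iⱽ Iⱽ
    1ⱽ  : ∀ X → Cell Iᴴ Iᴴ X X

    ∣-cong : ∀ {t t′ b b′ l m r} {α α′ : Cell t b l m} {β β′ : Cell t′ b′ m r} →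
             α ≈ α′ → β ≈ β′ → α ∣ β ≈ α′ ∣ β′
    /-cong : ∀ {t m b l l′ r r′} {α α′ : Cell t m l r} {β β′ : Cell m b l′ r′} →
             α ≈ α′ → β ≈ β′ → α / β ≈ α′ / β′

    ∣-assoc : ∀ {t t′ t″ b b′ b″ k l m n}
              (α : Cell t b k l) (β : Cell t′ b′ l m) (γ : Cell t″ b″ m n) →
              castᴴ (H.assoc t t′ t″) (H.assoc b b′ b″) ((α ∣ β) ∣ γ) ≈ α ∣ (β ∣ γ)
    ∣-identityˡ : ∀ {t b l r} (α : Cell t b l r) →
                  castᴴ (H.identityˡ t) (H.identityˡ b) (1ⱽ l ∣ α) ≈ α
    ∣-identityʳ : ∀ {t b l r} (α : Cell t b l r) →
                  castᴴ (H.identityʳ t) (H.identityʳ b) (α ∣ 1ⱽ r) ≈ α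

    /-assoc : ∀ {k m n p l l′ l″ r r′ r″}
              (α : Cell k m l r) (β : Cell m n l′ r′) (γ : Cell n p l″ r″) →
              castⱽ (V.assoc l l′ l″) (V.assoc r r′ r″) ((α / β) / γ) ≈ α / (β / γ)
    /-identityˡ : ∀ {t b l r} (α : Cell t b l r) →
                  castⱽ (V.identityˡ l) (V.identityˡ r) (1ᴴ t / α) ≈ α
    /-identityʳ : ∀ {t b l r} (α : Cell t b l r) →
                  castⱽ (V.identityʳ l) (V.identityʳ r) (α / 1ᴴ b) ≈ α

    1ᴴ-∣ : ∀ A B → 1ᴴ A ∣ 1ᴴ B ≈ 1ᴴ (A ⊗ᴴ B)
    1ⱽ-/ : ∀ X Y → 1ⱽ X / 1ⱽ Y ≈ 1ⱽ (X ⊗ⱽ Y)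
    1ᴴ≈1ⱽ : 1ᴴ Iᴴ ≈ 1ⱽ Iⱽ

    interchange : ∀ {t t′ m m′ b b′ l l′ n n′ r r′}
                  (α : Cell t m l n) (β : Cell m b l′ n′)
                  (γ : Cell t′ m′ n r) (δ : Cell m′ b′ n′ r′) →
                  (α / β) ∣ (γ / δ) ≈ (α ∣ γ) / (β ∣ δ)

-- Equality of cells whose boundaries agree only propositionally.

module Heterogeneous {o v c e} (𝔻 : SingleObjectDoubleCategory o v c e) where
  open SingleObjectDoubleCategory 𝔻
  private module ≈ {t b l r} = IsEquivalence (≈-isEquivalence {t} {b} {l} {r})

  infix 4 _≅_

  data _≅_ {t b l r} (α : Cell t b l r) :
           ∀ {t′ b′ l′ r′} → Cell t′ b′ l′ r′ → Set (o ⊔ v ⊔ c ⊔ e) where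
    ≈⇒≅ : {β : Cell t b l r} → α ≈ β → α ≅ β

  ≅⇒≈ : ∀ {t b l r} {α β : Cell t b l r} → α ≅ β → α ≈ β
  ≅⇒≈ (≈⇒≅ p) = p

  ≅-refl : ∀ {t b l r} {α : Cell t b l r} → α ≅ α
  ≅-refl = ≈⇒≅ ≈.refl

  ≅-sym : ∀ {t b l r t′ b′ l′ r′} {α : Cell t b l r} {β : Cell t′ b′ l′ r′} →
          α ≅ β → β ≅ α
  ≅-sym (≈⇒≅ p) = ≈⇒≅ (≈.sym p)

  ≅-trans : ∀ {t b l r t′ b′ l′ r′ t″ b″ l″ r″}
            {α : Cell t b l r} {β : Cell t′ b′ l′ r′} {γ : Cell t″ b″ l″ r″} →
            α ≅ β → β ≅ γ → α ≅ γ
  ≅-trans (≈⇒≅ p) (≈⇒≅ q) = ≈⇒≅ (≈.trans p q)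

  ≅-∣ : ∀ {t t′ b b′ l m r u u′ d d′ x y z}
        {α : Cell t b l m} {α′ : Cell u d x y}
        {β : Cell t′ b′ m r} {β′ : Cell u′ d′ y z} →
        α ≅ α′ → β ≅ β′ → α ∣ β ≅ α′ ∣ β′
  ≅-∣ (≈⇒≅ p) (≈⇒≅ q) = ≈⇒≅ (∣-cong p q)

  ≅-/ : ∀ {t m b l l′ r r′ u n d x x′ y y′}
        {α : Cell t m l r} {α′ : Cell u n x y}
        {β : Cell m b l′ r′} {β′ : Cell n d x′ y′} →
        α ≅ α′ → β ≅ β′ → α / β ≅ α′ / β′
  ≅-/ (≈⇒≅ p) (≈⇒≅ q) = ≈⇒≅ (/-cong p q)

  castᴴ-≅ : ∀ {t t′ b b′ l r} (p : t ≡ t′) (q : b ≡ b′) (α : Cell t b l r) →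
            castᴴ p q α ≅ α
  castᴴ-≅ refl refl α = ≅-refl

  castⱽ-≅ : ∀ {t b l l′ r r′} (p : l ≡ l′) (q : r ≡ r′) (α : Cell t b l r) →
            castⱽ p q α ≅ α
  castⱽ-≅ refl refl α = ≅-refl

module HorizontalCells {o v c e} (𝔻 : SingleObjectDoubleCategory o v c e) where
  open SingleObjectDoubleCategory 𝔻
  open Heterogeneous 𝔻

  Hom : V → V → Set c
  Hom = Cell Iᴴ Iᴴ

  infixr 6 _⨾_
  _⨾_ : ∀ {X Y Z} → Hom X Y → Hom Y Z → Hom X Z
  h ⨾ k = castᴴ (H.identityˡ Iᴴ) (H.identityˡ Iᴴ) (h ∣ k)

  private
    ⨾-≅ : ∀ {X Y Z} (h : Hom X Y) (k : Hom Y Z) → h ⨾ k ≅ h ∣ k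
    ⨾-≅ h k = castᴴ-≅ (H.identityˡ Iᴴ) (H.identityˡ Iᴴ) (h ∣ k)

    uncastᴴ : ∀ {t t′ b b′ l r t″ b″ l″ r″} (p : t ≡ t′) (q : b ≡ b′)
              {α : Cell t b l r} {β : Cell t″ b″ l″ r″} → castᴴ p q α ≅ β → α ≅ β
    uncastᴴ refl refl x = x

  𝐇 : StrictMonoidalCategory v c e
  𝐇 = record
    { Obj = V
    ; Hom = Hom
    ; _≈_ = _≈_
    ; id = 1ⱽ
    ; _⨾_ = _⨾_
    ; ≈-isEquivalence = ≈-isEquivalence
    ; ⨾-cong = λ {_} {_} {_} {f} {f′} {g} {g′} p q → ≅⇒≈
        (≅-trans (⨾-≅ f g) (≅-trans (≈⇒≅ (∣-cong p q)) (≅-sym (⨾-≅ f′ g′))))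
    ; ⨾-assoc = λ f g h → ≅⇒≈
        (≅-trans (⨾-≅ (f ⨾ g) h)
        (≅-trans (≅-∣ (⨾-≅ f g) ≅-refl)
        (≅-trans (uncastᴴ (H.assoc _ _ _) (H.assoc _ _ _) (≈⇒≅ (∣-assoc f g h)))
        (≅-trans (≅-∣ ≅-refl (≅-sym (⨾-≅ g h)))
                 (≅-sym (⨾-≅ f (g ⨾ h)))))))
    ; ⨾-identityˡ = λ f → ≅⇒≈
        (≅-trans (⨾-≅ _ f)
                 (uncastᴴ (H.identityˡ _) (H.identityˡ _) (≈⇒≅ (∣-identityˡ f))))
    ; ⨾-identityʳ = λ f → ≅⇒≈
        (≅-trans (⨾-≅ f _)
                 (uncastᴴ (H.identityʳ _) (H.identityʳ _) (≈⇒≅ (∣-identityʳ f))))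
    ; _⊗₀_ = _⊗ⱽ_
    ; I = Iⱽ
    ; ⊗₀-isMonoid = V-isMonoid
    ; _⊗₁_ = _/_
    ; ⊗₁-cong = /-cong
    ; ⊗₁-id = 1ⱽ-/
    ; ⊗₁-⨾ = λ f g f′ g′ → ≅⇒≈
        (≅-trans (≅-/ (⨾-≅ f g) (⨾-≅ f′ g′))
        (≅-trans (≅-sym (≈⇒≅ (interchange f f′ g g′)))
                 (≅-sym (⨾-≅ (f / f′) (g / g′)))))
    ; ⊗₁-assoc = /-assoc
    ; ⊗₁-identityˡ = λ f → ≅⇒≈
        (≅-trans (castⱽ-≅ (V.identityˡ _) (V.identityˡ _) _)
        (≅-trans (≅-/ (≅-sym (≈⇒≅ 1ᴴ≈1ⱽ)) ≅-refl)
        (≅-trans (≅-sym (castⱽ-≅ (V.identityˡ _) (V.identityˡ _) _))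
                 (≈⇒≅ (/-identityˡ f)))))
    ; ⊗₁-identityʳ = λ f → ≅⇒≈
        (≅-trans (castⱽ-≅ (V.identityʳ _) (V.identityʳ _) _)
        (≅-trans (≅-/ ≅-refl (≅-sym (≈⇒≅ 1ᴴ≈1ⱽ)))
        (≅-trans (≅-sym (castⱽ-≅ (V.identityʳ _) (V.identityʳ _) _))
                 (≈⇒≅ (/-identityʳ f)))))
    }

open HorizontalCells public using (𝐇)

data Polarity : Set where
  ∘ • : Polarity

-- The free single-object double category: formal composites of the generating
-- cells, modulo the least congruence containing the single-object double
-- category axioms and the defining equations.

module FreeCornering {o ℓ e} (𝔸 : SymmetricStrictMonoidalCategory o ℓ e) where
  private module 𝔸 = SymmetricStrictMonoidalCategory 𝔸
  open 𝔸 using (_⊗₀_; I; ⊗₀-assoc; ⊗₀-identityˡ; ⊗₀-identityʳ)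

  𝔸∘• : Set o
  𝔸∘• = List (𝔸.Obj × Polarity)

  private
    module V = IsMonoid (++-isMonoid {A = 𝔸.Obj × Polarity})

  infix  9 _° _⦁
  _° _⦁ : 𝔸.Obj → 𝔸∘•
  A ° = [ A , ∘ ]
  A ⦁ = [ A , • ]

  infixr 6 _∣_
  infixr 7 _/_

  data Cell : (t b : 𝔸.Obj) (l r : 𝔸∘•) → Set (o ⊔ ℓ) where
    s° : ∀ A → Cell A I [] (A °)
    r° : ∀ A → Cell I A (A °) []
    s• : ∀ A → Cell A I (A ⦁) []
    r• : ∀ A → Cell I A [] (A ⦁)
    ⌜_⌝ : ∀ {A B} → 𝔸.Hom A B → Cell A B [] []
    _∣_ : ∀ {t t′ b b′ l m r} →
          Cell t b l m → Cell t′ b′ m r → Cell (t ⊗₀ t′) (b ⊗₀ b′) l r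
    _/_ : ∀ {t m b l l′ r r′} →
          Cell t m l r → Cell m b l′ r′ → Cell t b (l ++ l′) (r ++ r′)
    1ᴴ  : ∀ A → Cell A A [] []
    1ⱽ  : ∀ X → Cell I I X X

  castᴴ : ∀ {t t′ b b′ l r} → t ≡ t′ → b ≡ b′ → Cell t b l r → Cell t′ b′ l r
  castᴴ {l = l} {r} = subst₂ (λ t b → Cell t b l r)

  castⱽ : ∀ {t b l l′ r r′} → l ≡ l′ → r ≡ r′ → Cell t b l r → Cell t b l′ r′
  castⱽ {t} {b} = subst₂ (Cell t b)

  infix 4 _≈_

  data _≈_ : ∀ {t b l r} → Cell t b l r → Cell t b l r → Set (o ⊔ ℓ ⊔ e) where
    ≈-refl  : ∀ {t b l r} {α : Cell t b l r} → α ≈ α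
    ≈-sym   : ∀ {t b l r} {α β : Cell t b l r} → α ≈ β → β ≈ α
    ≈-trans : ∀ {t b l r} {α β γ : Cell t b l r} → α ≈ β → β ≈ γ → α ≈ γ
    ∣-cong : ∀ {t t′ b b′ l m r} {α α′ : Cell t b l m} {β β′ : Cell t′ b′ m r} →
             α ≈ α′ → β ≈ β′ → α ∣ β ≈ α′ ∣ β′
    /-cong : ∀ {t m b l l′ r r′} {α α′ : Cell t m l r} {β β′ : Cell m b l′ r′} →
             α ≈ α′ → β ≈ β′ → α / β ≈ α′ / β′
    ⌜⌝-cong : ∀ {A B} {f g : 𝔸.Hom A B} → f 𝔸.≈ g → ⌜ f ⌝ ≈ ⌜ g ⌝

    ∣-assoc : ∀ {t t′ t″ b b′ b″ k l m n}
              (α : Cell t b k l) (β : Cell t′ b′ l m) (γ : Cell t″ b″ m n) →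
              castᴴ (⊗₀-assoc t t′ t″) (⊗₀-assoc b b′ b″) ((α ∣ β) ∣ γ) ≈ α ∣ (β ∣ γ)
    ∣-identityˡ : ∀ {t b l r} (α : Cell t b l r) →
                  castᴴ (⊗₀-identityˡ t) (⊗₀-identityˡ b) (1ⱽ l ∣ α) ≈ α
    ∣-identityʳ : ∀ {t b l r} (α : Cell t b l r) →
                  castᴴ (⊗₀-identityʳ t) (⊗₀-identityʳ b) (α ∣ 1ⱽ r) ≈ α
    /-assoc : ∀ {k m n p l l′ l″ r r′ r″}
              (α : Cell k m l r) (β : Cell m n l′ r′) (γ : Cell n p l″ r″) →
              castⱽ (V.assoc l l′ l″) (V.assoc r r′ r″) ((α / β) / γ) ≈ α / (β / γ)
    /-identityˡ : ∀ {t b l r} (α : Cell t b l r) →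
                  castⱽ (V.identityˡ l) (V.identityˡ r) (1ᴴ t / α) ≈ α
    /-identityʳ : ∀ {t b l r} (α : Cell t b l r) →
                  castⱽ (V.identityʳ l) (V.identityʳ r) (α / 1ᴴ b) ≈ α
    1ᴴ-∣ : ∀ A B → 1ᴴ A ∣ 1ᴴ B ≈ 1ᴴ (A ⊗₀ B)
    1ⱽ-/ : ∀ X Y → 1ⱽ X / 1ⱽ Y ≈ 1ⱽ (X ++ Y)
    1ᴴ≈1ⱽ : 1ᴴ I ≈ 1ⱽ []
    interchange : ∀ {t t′ m m′ b b′ l l′ n n′ r r′}
                  (α : Cell t m l n) (β : Cell m b l′ n′)
                  (γ : Cell t′ m′ n r) (δ : Cell m′ b′ n′ r′) →
                  (α / β) ∣ (γ / δ) ≈ (α ∣ γ) / (β ∣ δ)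

    -- The vertical yanking equations need no transport: [ x ] ++ [] and
    -- [] ++ [ x ] both compute to [ x ].
    yank-s°∣r° : ∀ A → castᴴ (⊗₀-identityʳ A) (⊗₀-identityˡ A) (s° A ∣ r° A) ≈ 1ᴴ A
    yank-r°/s° : ∀ A → r° A / s° A ≈ 1ⱽ (A °)
    yank-r•∣s• : ∀ A → castᴴ (⊗₀-identityˡ A) (⊗₀-identityʳ A) (r• A ∣ s• A) ≈ 1ᴴ A
    yank-r•/s• : ∀ A → r• A / s• A ≈ 1ⱽ (A ⦁)

    ⌜⌝-⨾  : ∀ {A B C} (f : 𝔸.Hom A B) (g : 𝔸.Hom B C) → ⌜ f ⌝ / ⌜ g ⌝ ≈ ⌜ f 𝔸.⨾ g ⌝
    ⌜⌝-id : ∀ A → ⌜ 𝔸.id A ⌝ ≈ 1ᴴ A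
    ⌜⌝-⊗  : ∀ {A B C D} (f : 𝔸.Hom A B) (g : 𝔸.Hom C D) →
            ⌜ f ⌝ ∣ ⌜ g ⌝ ≈ ⌜ f 𝔸.⊗₁ g ⌝

  𝒞 : SingleObjectDoubleCategory o o (o ⊔ ℓ) (o ⊔ ℓ ⊔ e)
  𝒞 = record
    { H = 𝔸.Obj
    ; _⊗ᴴ_ = _⊗₀_
    ; Iᴴ = I
    ; H-isMonoid = 𝔸.⊗₀-isMonoid
    ; V = 𝔸∘•
    ; _⊗ⱽ_ = _++_
    ; Iⱽ = []
    ; V-isMonoid = ++-isMonoid
    ; Cell = Cell
    ; _≈_ = _≈_
    ; ≈-isEquivalence = record { refl = ≈-refl ; sym = ≈-sym ; trans = ≈-trans }
    ; _∣_ = _∣_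
    ; _/_ = _/_
    ; 1ᴴ = 1ᴴ
    ; 1ⱽ = 1ⱽ
    ; ∣-cong = ∣-cong
    ; /-cong = /-cong
    ; ∣-assoc = ∣-assoc
    ; ∣-identityˡ = ∣-identityˡ
    ; ∣-identityʳ = ∣-identityʳ
    ; /-assoc = /-assoc
    ; /-identityˡ = /-identityˡ
    ; /-identityʳ = /-identityʳ
    ; 1ᴴ-∣ = 1ᴴ-∣
    ; 1ⱽ-/ = 1ⱽ-/
    ; 1ᴴ≈1ⱽ = 1ᴴ≈1ⱽ
    ; interchange = interchange
    }

open FreeCornering public using (𝒞)

{-# OPTIONS --safe #-}

-- The symmetry of 𝔸 yields cells χ A X in which a horizontal edge A crosses a
-- vertical edge X.  By induction on α, every cell α can be pulled through A:
-- (χ A l ∣ α) / σ A b  equals  σ A t / (α ∣ χ A r).  For a cell h whose four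
-- boundaries are all trivial this says that h passes through every horizontal
-- edge, hence through every corner, hence through 1 on A ° and A ⦁, which are
-- vertical composites of corners by yanking.

module Submission where

open import Level using (Level)
open import Data.List.Base using ([]; _∷_; _++_; [_])
open import Data.Product.Base using (_,_)
open import Relation.Binary.PropositionalEquality
  using (_≡_; refl; sym; trans)
open import Defs

-- Double category laws for cells whose boundaries agree only propositionally.

module HeterogeneousLaws {o v c e} (𝔻 : SingleObjectDoubleCategory o v c e) where
  open SingleObjectDoubleCategory 𝔻
  open Heterogeneous 𝔻 public

  infix  1 begin_
  infixr 2 _≅⟨_⟩_
  infix  3 _∎

  begin_ : ∀ {t b l r t′ b′ l′ r′} {α : Cell t b l r} {β : Cell t′ b′ l′ r′} →
           α ≅ β → α ≅ β
  begin p = p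

  _≅⟨_⟩_ : ∀ {t b l r t′ b′ l′ r′ t″ b″ l″ r″}
           (α : Cell t b l r) {β : Cell t′ b′ l′ r′} {γ : Cell t″ b″ l″ r″} →
           α ≅ β → β ≅ γ → α ≅ γ
  α ≅⟨ p ⟩ q = ≅-trans p q

  _∎ : ∀ {t b l r} (α : Cell t b l r) → α ≅ α
  α ∎ = ≅-refl

  infixr 7 _/⟨_⟩_
  -- Storing the equation of the meeting edges in the composite keeps casts out of the cells. In
  -- `≅-/⟨⟩` the two equations are independent, so a rewrite may also replace the meeting edge, say
  -- by a reassociated one.
  _/⟨_⟩_ : ∀ {t m m′ b l l′ r r′} →
           Cell t m l r → m ≡ m′ → Cell m′ b l′ r′ → Cell t b (l ⊗ⱽ l′) (r ⊗ⱽ r′)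
  α /⟨ refl ⟩ β = α / β

  ≅-/⟨⟩ : ∀ {t m m′ b l l′ r r′ u n n′ d x x′ y y′}
          {α : Cell t m l r} {α′ : Cell u n x y}
          {β : Cell m′ b l′ r′} {β′ : Cell n′ d x′ y′}
          (p : m ≡ m′) (q : n ≡ n′) →
          α ≅ α′ → β ≅ β′ → α /⟨ p ⟩ β ≅ α′ /⟨ q ⟩ β′
  ≅-/⟨⟩ refl refl (≈⇒≅ p) (≈⇒≅ q) = ≈⇒≅ (/-cong p q)

  ≅-1ᴴ : ∀ {A B} → A ≡ B → 1ᴴ A ≅ 1ᴴ B
  ≅-1ᴴ refl = ≅-refl

  assoc-∣ : ∀ {t t′ t″ b b′ b″ k l m n}
            (α : Cell t b k l) (β : Cell t′ b′ l m) (γ : Cell t″ b″ m n) →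
            (α ∣ β) ∣ γ ≅ α ∣ (β ∣ γ)
  assoc-∣ α β γ = ≅-trans (≅-sym (castᴴ-≅ _ _ _)) (≈⇒≅ (∣-assoc α β γ))

  identityˡ-∣ : ∀ {t b l r} (α : Cell t b l r) → 1ⱽ l ∣ α ≅ α
  identityˡ-∣ α = ≅-trans (≅-sym (castᴴ-≅ _ _ _)) (≈⇒≅ (∣-identityˡ α))

  identityʳ-∣ : ∀ {t b l r} (α : Cell t b l r) → α ∣ 1ⱽ r ≅ α
  identityʳ-∣ α = ≅-trans (≅-sym (castᴴ-≅ _ _ _)) (≈⇒≅ (∣-identityʳ α))

  1ᴴI-∣ : ∀ {t b r} (α : Cell t b Iⱽ r) → 1ᴴ Iᴴ ∣ α ≅ α
  1ᴴI-∣ α = ≅-trans (≅-∣ (≈⇒≅ 1ᴴ≈1ⱽ) ≅-refl) (identityˡ-∣ α)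

  ∣-1ᴴI : ∀ {t b l} (α : Cell t b l Iⱽ) → α ∣ 1ᴴ Iᴴ ≅ α
  ∣-1ᴴI α = ≅-trans (≅-∣ ≅-refl (≈⇒≅ 1ᴴ≈1ⱽ)) (identityʳ-∣ α)

  assoc-/ : ∀ {k m n p l l′ l″ r r′ r″}
            (α : Cell k m l r) (β : Cell m n l′ r′) (γ : Cell n p l″ r″) →
            (α / β) / γ ≅ α / (β / γ)
  assoc-/ α β γ = ≅-trans (≅-sym (castⱽ-≅ _ _ _)) (≈⇒≅ (/-assoc α β γ))

  assoc-/⟨⟩ : ∀ {k m m′ n n′ p l l′ l″ r r′ r″} (e : m ≡ m′) (f : n ≡ n′)
              (α : Cell k m l r) (β : Cell m′ n l′ r′) (γ : Cell n′ p l″ r″) →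
              (α /⟨ e ⟩ β) /⟨ f ⟩ γ ≅ α /⟨ e ⟩ (β /⟨ f ⟩ γ)
  assoc-/⟨⟩ refl refl = assoc-/

  identityˡ-/ : ∀ {t b l r} (α : Cell t b l r) → 1ᴴ t / α ≅ α
  identityˡ-/ α = ≅-trans (≅-sym (castⱽ-≅ _ _ _)) (≈⇒≅ (/-identityˡ α))

  identityʳ-/ : ∀ {t b l r} (α : Cell t b l r) → α / 1ᴴ b ≅ α
  identityʳ-/ α = ≅-trans (≅-sym (castⱽ-≅ _ _ _)) (≈⇒≅ (/-identityʳ α))

  -- Serves to evaluate a corner placed beside a crossing, which is built from three rows.
  interchange₃ : ∀ {t m n b t′ m′ n′ b′ l₁ l₂ l₃ k₁ k₂ k₃ r₁ r₂ r₃}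
    (α : Cell t m l₁ k₁) (β : Cell m n l₂ k₂) (γ : Cell n b l₃ k₃)
    (α′ : Cell t′ m′ k₁ r₁) (β′ : Cell m′ n′ k₂ r₂) (γ′ : Cell n′ b′ k₃ r₃) →
    ((α / β) / γ) ∣ ((α′ / β′) / γ′) ≅ ((α ∣ α′) / (β ∣ β′)) / (γ ∣ γ′)
  interchange₃ α β γ α′ β′ γ′ =
    ≅-trans (≈⇒≅ (interchange (α / β) γ (α′ / β′) γ′))
            (≅-/ (≈⇒≅ (interchange α β α′ β′)) ≅-refl)

  -- Cells that meet along the trivial vertical edge can be padded above or below with identities;
  -- interchange then lets either one come first.
  ∣-left-first : ∀ {t b l t′ b′ r} (α : Cell t b l Iⱽ) (β : Cell t′ b′ Iⱽ r) →
                 α ∣ β ≅ (α ∣ 1ᴴ t′) / (1ᴴ b ∣ β)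
  ∣-left-first {b = b} {t′ = t′} α β = begin
    α ∣ β                     ≅⟨ ≅-sym (≅-∣ (identityʳ-/ α) (identityˡ-/ β)) ⟩
    (α / 1ᴴ b) ∣ (1ᴴ t′ / β)  ≅⟨ ≈⇒≅ (interchange α (1ᴴ b) (1ᴴ t′) β) ⟩
    (α ∣ 1ᴴ t′) / (1ᴴ b ∣ β)  ∎

  ∣-right-first : ∀ {t b l t′ b′ r} (α : Cell t b l Iⱽ) (β : Cell t′ b′ Iⱽ r) →
                  α ∣ β ≅ (1ᴴ t ∣ β) / (α ∣ 1ᴴ b′)
  ∣-right-first {t = t} {b′ = b′} α β = begin
    α ∣ β                     ≅⟨ ≅-sym (≅-∣ (identityˡ-/ α) (identityʳ-/ β)) ⟩
    (1ᴴ t / α) ∣ (β / 1ᴴ b′)  ≅⟨ ≈⇒≅ (interchange (1ᴴ t) α β (1ᴴ b′)) ⟩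
    (1ᴴ t ∣ β) / (α ∣ 1ᴴ b′)  ∎

module Crossing {o ℓ e} (𝔸 : SymmetricStrictMonoidalCategory o ℓ e) where
  private module 𝔸 = SymmetricStrictMonoidalCategory 𝔸
  open 𝔸 using (_⊗₀_; I; ⊗₀-assoc; ⊗₀-identityˡ; ⊗₀-identityʳ)
  open FreeCornering 𝔸 hiding (𝒞)
  open HeterogeneousLaws (𝒞 𝔸)

  -- The symmetry as cells: involutivity, hexagon and unit coherence.

  σ : ∀ A B → Cell (A ⊗₀ B) (B ⊗₀ A) [] []
  σ A B = ⌜ 𝔸.σ A B ⌝

  ⌜cast⌝ : ∀ {A A′ B B′} (p : A ≡ A′) (q : B ≡ B′) (f : 𝔸.Hom A B) →
           ⌜ 𝔸.cast p q f ⌝ ≅ ⌜ f ⌝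
  ⌜cast⌝ refl refl f = ≅-refl

  1∣1 : ∀ A B → 1ᴴ A ∣ 1ᴴ B ≅ 1ᴴ (A ⊗₀ B)
  1∣1 A B = ≈⇒≅ (1ᴴ-∣ A B)

  ⌜id⊗⌝ : ∀ A {B C} (f : 𝔸.Hom B C) → ⌜ 𝔸.id A 𝔸.⊗₁ f ⌝ ≅ 1ᴴ A ∣ ⌜ f ⌝
  ⌜id⊗⌝ A f = ≅-trans (≅-sym (≈⇒≅ (⌜⌝-⊗ (𝔸.id A) f))) (≅-∣ (≈⇒≅ (⌜⌝-id A)) ≅-refl)

  ⌜⊗id⌝ : ∀ A {B C} (f : 𝔸.Hom B C) → ⌜ f 𝔸.⊗₁ 𝔸.id A ⌝ ≅ ⌜ f ⌝ ∣ 1ᴴ A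
  ⌜⊗id⌝ A f = ≅-trans (≅-sym (≈⇒≅ (⌜⌝-⊗ f (𝔸.id A)))) (≅-∣ ≅-refl (≈⇒≅ (⌜⌝-id A)))

  σ-involutive : ∀ A B → σ A B / σ B A ≅ 1ᴴ (A ⊗₀ B)
  σ-involutive A B = begin
    σ A B / σ B A              ≅⟨ ≈⇒≅ (⌜⌝-⨾ (𝔸.σ A B) (𝔸.σ B A)) ⟩
    ⌜ 𝔸.σ A B 𝔸.⨾ 𝔸.σ B A ⌝    ≅⟨ ≈⇒≅ (⌜⌝-cong (𝔸.σ-involutive A B)) ⟩
    ⌜ 𝔸.id (A ⊗₀ B) ⌝          ≅⟨ ≈⇒≅ (⌜⌝-id (A ⊗₀ B)) ⟩
    1ᴴ (A ⊗₀ B)                ∎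

  σ-hexagon : ∀ A B C →
    σ A (B ⊗₀ C) ≅ (σ A B ∣ 1ᴴ C) /⟨ ⊗₀-assoc B A C ⟩ (1ᴴ B ∣ σ A C)
  σ-hexagon A B C = begin
    σ A (B ⊗₀ C)
      ≅⟨ ≅-sym (⌜cast⌝ refl (⊗₀-assoc B C A) _) ⟩
    ⌜ 𝔸.cast refl (⊗₀-assoc B C A) (𝔸.σ A (B ⊗₀ C)) ⌝
      ≅⟨ ≈⇒≅ (⌜⌝-cong (𝔸.σ-hexagon A B C)) ⟩
    ⌜ σ⊗id 𝔸.⨾ id⊗σ ⌝
      ≅⟨ ≅-sym (≈⇒≅ (⌜⌝-⨾ σ⊗id id⊗σ)) ⟩
    ⌜ σ⊗id ⌝ / ⌜ id⊗σ ⌝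
      ≅⟨ ≅-/⟨⟩ refl (⊗₀-assoc B A C)
           (≅-trans (⌜cast⌝ (⊗₀-assoc A B C) (⊗₀-assoc B A C) _) (⌜⊗id⌝ C (𝔸.σ A B)))
           (⌜id⊗⌝ B (𝔸.σ A C)) ⟩
    (σ A B ∣ 1ᴴ C) /⟨ ⊗₀-assoc B A C ⟩ (1ᴴ B ∣ σ A C)
      ∎
    where
    σ⊗id = 𝔸.cast (⊗₀-assoc A B C) (⊗₀-assoc B A C) (𝔸.σ A B 𝔸.⊗₁ 𝔸.id C)
    id⊗σ = 𝔸.id B 𝔸.⊗₁ 𝔸.σ A C

  ≅-σ : ∀ A {B C} → B ≡ C → σ A B ≅ σ A C
  ≅-σ A refl = ≅-refl

  -- The hexagon at I ⊗ I makes σ A I idempotent, and it is invertible.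
  σ-unit : ∀ A → σ A I ≅ 1ᴴ A
  σ-unit A = ≅-sym (begin
    1ᴴ A
      ≅⟨ ≅-1ᴴ (sym (⊗₀-identityʳ A)) ⟩
    1ᴴ (A ⊗₀ I)
      ≅⟨ ≅-sym (σ-involutive A I) ⟩
    σ A I / σ I A
      ≅⟨ ≅-/⟨⟩ refl refl σ-idempotent ≅-refl ⟩
    (σ A I /⟨ IA≡AI ⟩ σ A I) /⟨ refl ⟩ σ I A
      ≅⟨ assoc-/⟨⟩ IA≡AI refl (σ A I) (σ A I) (σ I A) ⟩
    σ A I /⟨ IA≡AI ⟩ (σ A I / σ I A)
      ≅⟨ ≅-/⟨⟩ IA≡AI refl ≅-refl (≅-trans (σ-involutive A I) (≅-1ᴴ (sym IA≡AI))) ⟩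
    σ A I / 1ᴴ (I ⊗₀ A)
      ≅⟨ identityʳ-/ (σ A I) ⟩
    σ A I
      ∎)
    where
    IA≡AI : I ⊗₀ A ≡ A ⊗₀ I
    IA≡AI = trans (⊗₀-identityˡ A) (sym (⊗₀-identityʳ A))

    σ-idempotent : σ A I ≅ σ A I /⟨ IA≡AI ⟩ σ A I
    σ-idempotent = begin
      σ A I
        ≅⟨ ≅-σ A (sym (⊗₀-identityˡ I)) ⟩
      σ A (I ⊗₀ I)
        ≅⟨ σ-hexagon A I I ⟩
      (σ A I ∣ 1ᴴ I) /⟨ ⊗₀-assoc I A I ⟩ (1ᴴ I ∣ σ A I)
        ≅⟨ ≅-/⟨⟩ (⊗₀-assoc I A I) IA≡AI (∣-1ᴴI (σ A I)) (1ᴴI-∣ (σ A I)) ⟩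
      σ A I /⟨ IA≡AI ⟩ σ A I
        ∎

  -- Crossings of a horizontal edge with a vertical edge.

  -- `r° B` bends the vertical edge downwards, the symmetry carries it across `A`, and `s° B` bends
  -- it out to the right. In `crossing₁•` the wire runs from right to left, so `B` starts to the
  -- right of `A` and the symmetry is `σ A B`.
  crossing₁° : ∀ A B → Cell (I ⊗₀ A) (A ⊗₀ I) (B °) (B °)
  crossing₁° A B = ((r° B ∣ 1ᴴ A) / σ B A) / (1ᴴ A ∣ s° B)

  crossing₁• : ∀ A B → Cell (A ⊗₀ I) (I ⊗₀ A) (B ⦁) (B ⦁)
  crossing₁• A B = ((1ᴴ A ∣ r• B) / σ A B) / (s• B ∣ 1ᴴ A)

  χ₁ : ∀ A x → Cell A A [ x ] [ x ]
  χ₁ A (B , ∘) = castᴴ (⊗₀-identityˡ A) (⊗₀-identityʳ A) (crossing₁° A B)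
  χ₁ A (B , •) = castᴴ (⊗₀-identityʳ A) (⊗₀-identityˡ A) (crossing₁• A B)

  χ : ∀ A X → Cell A A X X
  χ A []      = 1ᴴ A
  χ A (x ∷ X) = χ₁ A x / χ A X

  χ-++ : ∀ A X Y → χ A (X ++ Y) ≅ χ A X / χ A Y
  χ-++ A []      Y = ≅-sym (identityˡ-/ (χ A Y))
  χ-++ A (x ∷ X) Y =
    ≅-trans (≅-/ ≅-refl (χ-++ A X Y)) (≅-sym (assoc-/ (χ₁ A x) (χ A X) (χ A Y)))

  χ-° : ∀ A B → χ A (B °) ≅ crossing₁° A B
  χ-° A B = ≅-trans (identityʳ-/ _) (castᴴ-≅ (⊗₀-identityˡ A) (⊗₀-identityʳ A) _)

  χ-⦁ : ∀ A B → χ A (B ⦁) ≅ crossing₁• A B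
  χ-⦁ A B = ≅-trans (identityʳ-/ _) (castᴴ-≅ (⊗₀-identityʳ A) (⊗₀-identityˡ A) _)

  -- The pull-through equation and its closure under both compositions.

  -- Naturality of the symmetry, extended to cells with nontrivial sides by putting `χ A` in place
  -- of the identity on `A`. The first composite has sides `l ++ []` and `r ++ []`, hence `≅`.
  PullsThrough : ∀ A {t b l r} → Cell t b l r → Set _
  PullsThrough A {t} {b} {l} {r} α = (χ A l ∣ α) / σ A b ≅ σ A t / (α ∣ χ A r)

  -- With `σ-unit-/`, removes the symmetry wherever the cell being pulled has a trivial bottom or
  -- top.
  /-σ-unit : ∀ A {t l r} (α : Cell t (A ⊗₀ I) l r) → α / σ A I ≅ α
  /-σ-unit A α =
    ≅-trans (≅-/⟨⟩ refl refl ≅-refl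
              (≅-trans (σ-unit A) (≅-1ᴴ (sym (⊗₀-identityʳ A)))))
            (identityʳ-/ α)

  σ-unit-/ : ∀ A {b l r} (α : Cell (I ⊗₀ A) b l r) → σ A I / α ≅ α
  σ-unit-/ A α =
    ≅-trans (≅-/⟨⟩ refl refl
              (≅-trans (σ-unit A) (≅-1ᴴ (sym (⊗₀-identityˡ A)))) ≅-refl)
            (identityˡ-/ α)

  s°∣r° : ∀ B → s° B ∣ r° B ≅ 1ᴴ B
  s°∣r° B = ≅-trans (≅-sym (castᴴ-≅ _ _ _)) (≈⇒≅ (yank-s°∣r° B))

  r•∣s• : ∀ B → r• B ∣ s• B ≅ 1ᴴ B
  r•∣s• B = ≅-trans (≅-sym (castᴴ-≅ _ _ _)) (≈⇒≅ (yank-r•∣s• B))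

  -- Pulling `β` releases a `σ A m` between the two rows, which is what pulling `α` consumes.
  pull-/ : ∀ A {t m b l l′ r r′} (α : Cell t m l r) (β : Cell m b l′ r′) →
           PullsThrough A α → PullsThrough A β → PullsThrough A (α / β)
  pull-/ A {t} {m} {b} {l} {l′} {r} {r′} α β pα pβ = begin
    (χ A (l ++ l′) ∣ (α / β)) / σ A b
      ≅⟨ ≅-/ (≅-∣ (χ-++ A l l′) ≅-refl) ≅-refl ⟩
    ((χ A l / χ A l′) ∣ (α / β)) / σ A b
      ≅⟨ ≅-/ (≈⇒≅ (interchange (χ A l) (χ A l′) α β)) ≅-refl ⟩
    ((χ A l ∣ α) / (χ A l′ ∣ β)) / σ A b
      ≅⟨ assoc-/ _ _ _ ⟩
    (χ A l ∣ α) / ((χ A l′ ∣ β) / σ A b)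
      ≅⟨ ≅-/ ≅-refl pβ ⟩
    (χ A l ∣ α) / (σ A m / (β ∣ χ A r′))
      ≅⟨ ≅-sym (assoc-/ _ _ _) ⟩
    ((χ A l ∣ α) / σ A m) / (β ∣ χ A r′)
      ≅⟨ ≅-/ pα ≅-refl ⟩
    (σ A t / (α ∣ χ A r)) / (β ∣ χ A r′)
      ≅⟨ assoc-/ _ _ _ ⟩
    σ A t / ((α ∣ χ A r) / (β ∣ χ A r′))
      ≅⟨ ≅-/ ≅-refl (≅-sym (≈⇒≅ (interchange α β (χ A r) (χ A r′)))) ⟩
    σ A t / ((α / β) ∣ (χ A r / χ A r′))
      ≅⟨ ≅-/ ≅-refl (≅-∣ ≅-refl (≅-sym (χ-++ A r r′))) ⟩
    σ A t / ((α / β) ∣ χ A (r ++ r′))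
      ∎

  -- The hexagon splits the symmetry into two steps. `left` uses the first to carry `A` across `α`,
  -- to a crossing with the edge `m` shared by `α` and `β`; `right` uses the second to carry it on
  -- across `β`. The hexagon for the top edges reassembles the result.
  pull-∣ : ∀ A {t t′ b b′ l m r} (α : Cell t b l m) (β : Cell t′ b′ m r) →
           PullsThrough A α → PullsThrough A β → PullsThrough A (α ∣ β)
  pull-∣ A {t} {t′} {b} {b′} {l} {m} {r} α β pα pβ = begin
    (χ A l ∣ (α ∣ β)) / σ A (b ⊗₀ b′)
      -- The row above ends in `A ⊗₀ (b ⊗₀ b′)`, while the expanded symmetry starts at
      -- `(A ⊗₀ b) ⊗₀ b′`.
      ≅⟨ ≅-/⟨⟩ refl (sym (⊗₀-assoc A b b′)) ≅-refl (σ-hexagon A b b′) ⟩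
    (χ A l ∣ (α ∣ β)) /⟨ sym (⊗₀-assoc A b b′) ⟩ ((σ A b ∣ 1ᴴ b′) /⟨ bAb′ ⟩ (1ᴴ b ∣ σ A b′))
      ≅⟨ ≅-/⟨⟩ (sym (⊗₀-assoc A b b′)) refl (≅-sym (assoc-∣ _ _ _)) ≅-refl ⟩
    ((χ A l ∣ α) ∣ β) / ((σ A b ∣ 1ᴴ b′) /⟨ bAb′ ⟩ (1ᴴ b ∣ σ A b′))
      ≅⟨ ≅-sym (assoc-/⟨⟩ refl bAb′ _ _ _) ⟩
    (((χ A l ∣ α) ∣ β) / (σ A b ∣ 1ᴴ b′)) /⟨ bAb′ ⟩ (1ᴴ b ∣ σ A b′)
      ≅⟨ ≅-/⟨⟩ bAb′ bAb′ left ≅-refl ⟩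
    ((σ A t ∣ 1ᴴ t′) / ((α ∣ χ A m) ∣ β)) /⟨ bAb′ ⟩ (1ᴴ b ∣ σ A b′)
      ≅⟨ assoc-/⟨⟩ refl bAb′ _ _ _ ⟩
    (σ A t ∣ 1ᴴ t′) / (((α ∣ χ A m) ∣ β) /⟨ bAb′ ⟩ (1ᴴ b ∣ σ A b′))
      ≅⟨ ≅-/⟨⟩ refl tAt′ ≅-refl right ⟩
    (σ A t ∣ 1ᴴ t′) /⟨ tAt′ ⟩ ((1ᴴ t ∣ σ A t′) / (α ∣ (β ∣ χ A r)))
      ≅⟨ ≅-sym (assoc-/⟨⟩ tAt′ refl _ _ _) ⟩
    ((σ A t ∣ 1ᴴ t′) /⟨ tAt′ ⟩ (1ᴴ t ∣ σ A t′)) / (α ∣ (β ∣ χ A r))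
      ≅⟨ ≅-/⟨⟩ refl refl (≅-sym (σ-hexagon A t t′)) (≅-sym (assoc-∣ _ _ _)) ⟩
    σ A (t ⊗₀ t′) / ((α ∣ β) ∣ χ A r)
      ∎
    where
    bAb′ : (b ⊗₀ A) ⊗₀ b′ ≡ b ⊗₀ (A ⊗₀ b′)
    bAb′ = ⊗₀-assoc b A b′
    tAt′ : (t ⊗₀ A) ⊗₀ t′ ≡ t ⊗₀ (A ⊗₀ t′)
    tAt′ = ⊗₀-assoc t A t′

    left : ((χ A l ∣ α) ∣ β) / (σ A b ∣ 1ᴴ b′) ≅ (σ A t ∣ 1ᴴ t′) / ((α ∣ χ A m) ∣ β)
    left = begin
      ((χ A l ∣ α) ∣ β) / (σ A b ∣ 1ᴴ b′)
        ≅⟨ ≅-sym (≈⇒≅ (interchange (χ A l ∣ α) (σ A b) β (1ᴴ b′))) ⟩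
      ((χ A l ∣ α) / σ A b) ∣ (β / 1ᴴ b′)
        -- `β` drops to the lower row to stay level with `α`.
        ≅⟨ ≅-∣ pα (≅-trans (identityʳ-/ β) (≅-sym (identityˡ-/ β))) ⟩
      (σ A t / (α ∣ χ A m)) ∣ (1ᴴ t′ / β)
        ≅⟨ ≈⇒≅ (interchange (σ A t) (α ∣ χ A m) (1ᴴ t′) β) ⟩
      (σ A t ∣ 1ᴴ t′) / ((α ∣ χ A m) ∣ β)
        ∎

    right : ((α ∣ χ A m) ∣ β) /⟨ bAb′ ⟩ (1ᴴ b ∣ σ A b′) ≅ (1ᴴ t ∣ σ A t′) / (α ∣ (β ∣ χ A r))
    right = begin
      ((α ∣ χ A m) ∣ β) /⟨ bAb′ ⟩ (1ᴴ b ∣ σ A b′)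
        ≅⟨ ≅-/⟨⟩ bAb′ refl (assoc-∣ α (χ A m) β) ≅-refl ⟩
      (α ∣ (χ A m ∣ β)) / (1ᴴ b ∣ σ A b′)
        ≅⟨ ≅-sym (≈⇒≅ (interchange α (1ᴴ b) (χ A m ∣ β) (σ A b′))) ⟩
      (α / 1ᴴ b) ∣ ((χ A m ∣ β) / σ A b′)
        ≅⟨ ≅-∣ (≅-trans (identityʳ-/ α) (≅-sym (identityˡ-/ α))) pβ ⟩
      (1ᴴ t / α) ∣ (σ A t′ / (β ∣ χ A r))
        ≅⟨ ≈⇒≅ (interchange (1ᴴ t) α (σ A t′) (β ∣ χ A r)) ⟩
      (1ᴴ t ∣ σ A t′) / (α ∣ (β ∣ χ A r))
        ∎

  -- Pulling the generating cells and the identities.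

  -- `s° B` yanks against the `r° B` in the top row of the crossing, leaving a `σ B A` that cancels
  -- with `σ A B`.
  pull-s° : ∀ A B → PullsThrough A (s° B)
  pull-s° A B = begin
    (1ᴴ A ∣ s° B) / σ A I
      ≅⟨ /-σ-unit A (1ᴴ A ∣ s° B) ⟩
    1ᴴ A ∣ s° B
      ≅⟨ ≅-sym (identityˡ-/ _) ⟩
    1ᴴ (A ⊗₀ B) / (1ᴴ A ∣ s° B)
      ≅⟨ ≅-/ (≅-sym (σ-involutive A B)) ≅-refl ⟩
    (σ A B / σ B A) / (1ᴴ A ∣ s° B)
      ≅⟨ assoc-/ _ _ _ ⟩
    σ A B / (σ B A / (1ᴴ A ∣ s° B))
      ≅⟨ ≅-/ ≅-refl (≅-sym s°∣χ) ⟩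
    σ A B / (s° B ∣ χ A (B °))
      ∎
    where
    row₁ : s° B ∣ (r° B ∣ 1ᴴ A) ≅ 1ᴴ (B ⊗₀ A)
    row₁ = begin
      s° B ∣ (r° B ∣ 1ᴴ A)  ≅⟨ ≅-sym (assoc-∣ (s° B) (r° B) (1ᴴ A)) ⟩
      (s° B ∣ r° B) ∣ 1ᴴ A  ≅⟨ ≅-∣ (s°∣r° B) ≅-refl ⟩
      1ᴴ B ∣ 1ᴴ A           ≅⟨ 1∣1 B A ⟩
      1ᴴ (B ⊗₀ A)           ∎

    s°∣χ : s° B ∣ χ A (B °) ≅ σ B A / (1ᴴ A ∣ s° B)
    s°∣χ = begin
      s° B ∣ χ A (B °)
        -- Padding below sets the corner level with the first of the three rows.
        ≅⟨ ≅-∣ (≅-sym (≅-trans (identityʳ-/ _) (identityʳ-/ (s° B)))) (χ-° A B) ⟩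
      ((s° B / 1ᴴ I) / 1ᴴ I) ∣ crossing₁° A B
        ≅⟨ interchange₃ (s° B) (1ᴴ I) (1ᴴ I) (r° B ∣ 1ᴴ A) (σ B A) (1ᴴ A ∣ s° B) ⟩
      ((s° B ∣ (r° B ∣ 1ᴴ A)) / (1ᴴ I ∣ σ B A)) / (1ᴴ I ∣ (1ᴴ A ∣ s° B))
        ≅⟨ ≅-/⟨⟩ refl refl (≅-/⟨⟩ refl refl row₁ (1ᴴI-∣ _)) (1ᴴI-∣ _) ⟩
      (1ᴴ (B ⊗₀ A) / σ B A) / (1ᴴ A ∣ s° B)
        ≅⟨ ≅-/ (identityˡ-/ (σ B A)) ≅-refl ⟩
      σ B A / (1ᴴ A ∣ s° B)
        ∎

  -- Here the yanking happens in the bottom row of the crossing, against its `s° B`; again `σ B A`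
  -- cancels with `σ A B`.
  pull-r° : ∀ A B → PullsThrough A (r° B)
  pull-r° A B = begin
    (χ A (B °) ∣ r° B) / σ A B
      ≅⟨ ≅-/⟨⟩ refl refl χ∣r° ≅-refl ⟩
    ((r° B ∣ 1ᴴ A) / σ B A) / σ A B
      ≅⟨ assoc-/ _ _ _ ⟩
    (r° B ∣ 1ᴴ A) / (σ B A / σ A B)
      ≅⟨ ≅-/ ≅-refl (σ-involutive B A) ⟩
    (r° B ∣ 1ᴴ A) / 1ᴴ (B ⊗₀ A)
      ≅⟨ identityʳ-/ _ ⟩
    r° B ∣ 1ᴴ A
      ≅⟨ ≅-sym (σ-unit-/ A (r° B ∣ 1ᴴ A)) ⟩
    σ A I / (r° B ∣ 1ᴴ A)
      ∎
    where
    row₃ : (1ᴴ A ∣ s° B) ∣ r° B ≅ 1ᴴ (A ⊗₀ B)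
    row₃ = begin
      (1ᴴ A ∣ s° B) ∣ r° B  ≅⟨ assoc-∣ (1ᴴ A) (s° B) (r° B) ⟩
      1ᴴ A ∣ (s° B ∣ r° B)  ≅⟨ ≅-∣ ≅-refl (s°∣r° B) ⟩
      1ᴴ A ∣ 1ᴴ B           ≅⟨ 1∣1 A B ⟩
      1ᴴ (A ⊗₀ B)           ∎

    χ∣r° : χ A (B °) ∣ r° B ≅ (r° B ∣ 1ᴴ A) / σ B A
    χ∣r° = begin
      χ A (B °) ∣ r° B
        -- Padding above sets the corner level with the third row.
        ≅⟨ ≅-∣ (χ-° A B) (≅-sym (≅-trans (≅-/ (identityˡ-/ (1ᴴ I)) ≅-refl) (identityˡ-/ (r° B)))) ⟩
      crossing₁° A B ∣ ((1ᴴ I / 1ᴴ I) / r° B)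
        ≅⟨ interchange₃ (r° B ∣ 1ᴴ A) (σ B A) (1ᴴ A ∣ s° B) (1ᴴ I) (1ᴴ I) (r° B) ⟩
      (((r° B ∣ 1ᴴ A) ∣ 1ᴴ I) / (σ B A ∣ 1ᴴ I)) / ((1ᴴ A ∣ s° B) ∣ r° B)
        ≅⟨ ≅-/⟨⟩ refl refl (≅-/⟨⟩ refl refl (∣-1ᴴI _) (∣-1ᴴI _)) row₃ ⟩
      ((r° B ∣ 1ᴴ A) / σ B A) / 1ᴴ (A ⊗₀ B)
        ≅⟨ identityʳ-/ _ ⟩
      (r° B ∣ 1ᴴ A) / σ B A
        ∎

  -- The crossing with `B ⦁` already contains `σ A B`, so once `σ A I` drops out, yanking in the top
  -- row leaves exactly the other side.
  pull-s• : ∀ A B → PullsThrough A (s• B)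
  pull-s• A B = begin
    (χ A (B ⦁) ∣ s• B) / σ A I
      ≅⟨ /-σ-unit A (χ A (B ⦁) ∣ s• B) ⟩
    χ A (B ⦁) ∣ s• B
      ≅⟨ ≅-∣ (χ-⦁ A B) (≅-sym (≅-trans (identityʳ-/ _) (identityʳ-/ (s• B)))) ⟩
    crossing₁• A B ∣ ((s• B / 1ᴴ I) / 1ᴴ I)
      ≅⟨ interchange₃ (1ᴴ A ∣ r• B) (σ A B) (s• B ∣ 1ᴴ A) (s• B) (1ᴴ I) (1ᴴ I) ⟩
    (((1ᴴ A ∣ r• B) ∣ s• B) / (σ A B ∣ 1ᴴ I)) / ((s• B ∣ 1ᴴ A) ∣ 1ᴴ I)
      ≅⟨ ≅-/⟨⟩ refl refl (≅-/⟨⟩ refl refl row₁ (∣-1ᴴI _)) (∣-1ᴴI _) ⟩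
    (1ᴴ (A ⊗₀ B) / σ A B) / (s• B ∣ 1ᴴ A)
      ≅⟨ ≅-/ (identityˡ-/ (σ A B)) ≅-refl ⟩
    σ A B / (s• B ∣ 1ᴴ A)
      ∎
    where
    row₁ : (1ᴴ A ∣ r• B) ∣ s• B ≅ 1ᴴ (A ⊗₀ B)
    row₁ = begin
      (1ᴴ A ∣ r• B) ∣ s• B  ≅⟨ assoc-∣ (1ᴴ A) (r• B) (s• B) ⟩
      1ᴴ A ∣ (r• B ∣ s• B)  ≅⟨ ≅-∣ ≅-refl (r•∣s• B) ⟩
      1ᴴ A ∣ 1ᴴ B           ≅⟨ 1∣1 A B ⟩
      1ᴴ (A ⊗₀ B)           ∎

  -- The right-hand side is the one to simplify: `r• B` yanks against the `s• B` in the bottom row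
  -- of the crossing.
  pull-r• : ∀ A B → PullsThrough A (r• B)
  pull-r• A B = ≅-sym (begin
    σ A I / (r• B ∣ χ A (B ⦁))
      ≅⟨ σ-unit-/ A (r• B ∣ χ A (B ⦁)) ⟩
    r• B ∣ χ A (B ⦁)
      ≅⟨ ≅-∣ (≅-sym (≅-trans (≅-/ (identityˡ-/ (1ᴴ I)) ≅-refl) (identityˡ-/ (r• B)))) (χ-⦁ A B) ⟩
    ((1ᴴ I / 1ᴴ I) / r• B) ∣ crossing₁• A B
      ≅⟨ interchange₃ (1ᴴ I) (1ᴴ I) (r• B) (1ᴴ A ∣ r• B) (σ A B) (s• B ∣ 1ᴴ A) ⟩
    ((1ᴴ I ∣ (1ᴴ A ∣ r• B)) / (1ᴴ I ∣ σ A B)) / (r• B ∣ (s• B ∣ 1ᴴ A))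
      ≅⟨ ≅-/⟨⟩ refl refl (≅-/⟨⟩ refl refl (1ᴴI-∣ _) (1ᴴI-∣ _)) row₃ ⟩
    ((1ᴴ A ∣ r• B) / σ A B) / 1ᴴ (B ⊗₀ A)
      ≅⟨ identityʳ-/ _ ⟩
    (1ᴴ A ∣ r• B) / σ A B
      ∎)
    where
    row₃ : r• B ∣ (s• B ∣ 1ᴴ A) ≅ 1ᴴ (B ⊗₀ A)
    row₃ = begin
      r• B ∣ (s• B ∣ 1ᴴ A)  ≅⟨ ≅-sym (assoc-∣ (r• B) (s• B) (1ᴴ A)) ⟩
      (r• B ∣ s• B) ∣ 1ᴴ A  ≅⟨ ≅-∣ (r•∣s• B) ≅-refl ⟩
      1ᴴ B ∣ 1ᴴ A           ≅⟨ 1∣1 B A ⟩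
      1ᴴ (B ⊗₀ A)           ∎

  pull-⌜⌝ : ∀ A {B C} (f : 𝔸.Hom B C) → PullsThrough A ⌜ f ⌝
  pull-⌜⌝ A {B} {C} f = begin
    (1ᴴ A ∣ ⌜ f ⌝) / σ A C              ≅⟨ ≅-/ (≅-sym (⌜id⊗⌝ A f)) ≅-refl ⟩
    ⌜ 𝔸.id A 𝔸.⊗₁ f ⌝ / σ A C           ≅⟨ ≈⇒≅ (⌜⌝-⨾ _ _) ⟩
    ⌜ (𝔸.id A 𝔸.⊗₁ f) 𝔸.⨾ 𝔸.σ A C ⌝     ≅⟨ ≈⇒≅ (⌜⌝-cong (𝔸.σ-natural (𝔸.id A) f)) ⟩
    ⌜ 𝔸.σ A B 𝔸.⨾ (f 𝔸.⊗₁ 𝔸.id A) ⌝     ≅⟨ ≅-sym (≈⇒≅ (⌜⌝-⨾ _ _)) ⟩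
    σ A B / ⌜ f 𝔸.⊗₁ 𝔸.id A ⌝           ≅⟨ ≅-/ ≅-refl (⌜⊗id⌝ A f) ⟩
    σ A B / (⌜ f ⌝ ∣ 1ᴴ A)              ∎

  pull-1ᴴ : ∀ A B → PullsThrough A (1ᴴ B)
  pull-1ᴴ A B = begin
    (1ᴴ A ∣ 1ᴴ B) / σ A B  ≅⟨ ≅-/ (1∣1 A B) ≅-refl ⟩
    1ᴴ (A ⊗₀ B) / σ A B    ≅⟨ identityˡ-/ (σ A B) ⟩
    σ A B                  ≅⟨ ≅-sym (identityʳ-/ (σ A B)) ⟩
    σ A B / 1ᴴ (B ⊗₀ A)    ≅⟨ ≅-/ ≅-refl (≅-sym (1∣1 B A)) ⟩
    σ A B / (1ᴴ B ∣ 1ᴴ A)  ∎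

  pull-1ⱽ : ∀ A X → PullsThrough A (1ⱽ X)
  pull-1ⱽ A X = begin
    (χ A X ∣ 1ⱽ X) / σ A I  ≅⟨ /-σ-unit A (χ A X ∣ 1ⱽ X) ⟩
    χ A X ∣ 1ⱽ X            ≅⟨ identityʳ-∣ (χ A X) ⟩
    χ A X                   ≅⟨ ≅-sym (identityˡ-∣ (χ A X)) ⟩
    1ⱽ X ∣ χ A X            ≅⟨ ≅-sym (σ-unit-/ A (1ⱽ X ∣ χ A X)) ⟩
    σ A I / (1ⱽ X ∣ χ A X)  ∎

  pull : ∀ A {t b l r} (α : Cell t b l r) → PullsThrough A α
  pull A (s° B)  = pull-s° A B
  pull A (r° B)  = pull-r° A B
  pull A (s• B)  = pull-s• A B
  pull A (r• B)  = pull-r• A B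
  pull A ⌜ f ⌝   = pull-⌜⌝ A f
  pull A (α ∣ β) = pull-∣ A α β (pull A α) (pull A β)
  pull A (α / β) = pull-/ A α β (pull A α) (pull A β)
  pull A (1ᴴ B)  = pull-1ᴴ A B
  pull A (1ⱽ X)  = pull-1ⱽ A X

  -- Sliding a cell with trivial boundaries past vertical identities.

  module _ (h : Cell I I [] []) where

    -- An instance of `pull`: `χ A []` is `1ᴴ A`, and both symmetries are `σ A I`, which drops out.
    h∣1≅1∣h : ∀ A → h ∣ 1ᴴ A ≅ 1ᴴ A ∣ h
    h∣1≅1∣h A = begin
      h ∣ 1ᴴ A            ≅⟨ ≅-sym (σ-unit-/ A (h ∣ 1ᴴ A)) ⟩
      σ A I / (h ∣ 1ᴴ A)  ≅⟨ ≅-sym (pull A h) ⟩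
      (1ᴴ A ∣ h) / σ A I  ≅⟨ /-σ-unit A (1ᴴ A ∣ h) ⟩
      1ᴴ A ∣ h            ∎

    -- The cast makes both horizontal boundaries exactly `A`, so that it composes vertically with
    -- any cell starting or ending at `A`.
    whisker : ∀ A → Cell A A [] []
    whisker A = castᴴ (⊗₀-identityˡ A) (⊗₀-identityˡ A) (h ∣ 1ᴴ A)

    whisker-left : ∀ A → whisker A ≅ h ∣ 1ᴴ A
    whisker-left A = castᴴ-≅ (⊗₀-identityˡ A) (⊗₀-identityˡ A) (h ∣ 1ᴴ A)

    whisker-right : ∀ A → whisker A ≅ 1ᴴ A ∣ h
    whisker-right A = ≅-trans (whisker-left A) (h∣1≅1∣h A)

    whisker-I : whisker I ≅ h
    whisker-I = ≅-trans (whisker-left I) (∣-1ᴴI h)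

    PassedBy : ∀ {t b l r} → Cell t b l r → Set _
    PassedBy {t} {b} α = whisker t / α ≅ α / whisker b

    -- A trivial left side leaves room for `h` there: both composites are `h ∣ α`, with one or the
    -- other factor made first.
    passed-left[] : ∀ {t b r} (α : Cell t b [] r) → PassedBy α
    passed-left[] {t} {b} α = begin
      whisker t / α
        ≅⟨ ≅-/⟨⟩ refl refl (whisker-left t) (≅-sym (1ᴴI-∣ α)) ⟩
      (h ∣ 1ᴴ t) / (1ᴴ I ∣ α)
        ≅⟨ ≅-sym (∣-left-first h α) ⟩
      h ∣ α
        ≅⟨ ∣-right-first h α ⟩
      (1ᴴ I ∣ α) / (h ∣ 1ᴴ b)
        ≅⟨ ≅-/⟨⟩ refl refl (1ᴴI-∣ α) (≅-sym (whisker-left b)) ⟩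
      α / whisker b
        ∎

    -- The mirror image, with `h` on the right of `α`. As `whisker` is defined with `h` on the left,
    -- `h∣1≅1∣h` enters through `whisker-right`.
    passed-right[] : ∀ {t b l} (α : Cell t b l []) → PassedBy α
    passed-right[] {t} {b} α = begin
      whisker t / α
        ≅⟨ ≅-/⟨⟩ refl refl (whisker-right t) (≅-sym (∣-1ᴴI α)) ⟩
      (1ᴴ t ∣ h) / (α ∣ 1ᴴ I)
        ≅⟨ ≅-sym (∣-right-first α h) ⟩
      α ∣ h
        ≅⟨ ∣-left-first α h ⟩
      (α ∣ 1ᴴ I) / (1ᴴ b ∣ h)
        ≅⟨ ≅-/⟨⟩ refl refl (∣-1ᴴI α) (≅-sym (whisker-right b)) ⟩
      α / whisker b
        ∎

    passed-/ : ∀ {t m b l l′ r r′} (α : Cell t m l r) (β : Cell m b l′ r′) →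
               PassedBy α → PassedBy β → PassedBy (α / β)
    passed-/ {t} {m} {b} α β pα pβ = begin
      whisker t / (α / β)  ≅⟨ ≅-sym (assoc-/ _ _ _) ⟩
      (whisker t / α) / β  ≅⟨ ≅-/ pα ≅-refl ⟩
      (α / whisker m) / β  ≅⟨ assoc-/ _ _ _ ⟩
      α / (whisker m / β)  ≅⟨ ≅-/ ≅-refl pβ ⟩
      α / (β / whisker b)  ≅⟨ ≅-sym (assoc-/ _ _ _) ⟩
      (α / β) / whisker b  ∎

    passed-≅ : ∀ {t b l r l′ r′} {α : Cell t b l r} {β : Cell t b l′ r′} →
               α ≅ β → PassedBy α → PassedBy β
    passed-≅ α≅β pα =
      ≅-trans (≅-/ ≅-refl (≅-sym α≅β)) (≅-trans pα (≅-/ α≅β ≅-refl))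

    -- The identity on a generator has two nontrivial sides, but yanking factors it into two
    -- corners, each with one trivial side.
    passed-1ⱽ : ∀ X → PassedBy (1ⱽ X)
    passed-1ⱽ []            = passed-left[] (1ⱽ [])
    passed-1ⱽ ((A , ∘) ∷ X) =
      passed-≅ (≈⇒≅ (1ⱽ-/ (A °) X))
        (passed-/ (1ⱽ (A °)) (1ⱽ X)
          (passed-≅ (≈⇒≅ (yank-r°/s° A))
            -- `h` passes `r° A` on its right and `s° A` on its left, changing sides at the edge `A`
            -- between them. For `A ⦁` the sides are exchanged.
            (passed-/ (r° A) (s° A) (passed-right[] (r° A)) (passed-left[] (s° A))))
          (passed-1ⱽ X))
    passed-1ⱽ ((A , •) ∷ X) =
      passed-≅ (≈⇒≅ (1ⱽ-/ (A ⦁) X))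
        (passed-/ (1ⱽ (A ⦁)) (1ⱽ X)
          (passed-≅ (≈⇒≅ (yank-r•/s• A))
            (passed-/ (r• A) (s• A) (passed-left[] (r• A)) (passed-right[] (s• A))))
          (passed-1ⱽ X))

    h/1≅1/h : ∀ X → h / 1ⱽ X ≅ 1ⱽ X / h
    h/1≅1/h X = begin
      h / 1ⱽ X          ≅⟨ ≅-/ (≅-sym whisker-I) ≅-refl ⟩
      whisker I / 1ⱽ X  ≅⟨ passed-1ⱽ X ⟩
      1ⱽ X / whisker I  ≅⟨ ≅-/ ≅-refl whisker-I ⟩
      1ⱽ X / h          ∎

lemma6p2 : ∀ {o ℓ e : Level} (𝔸 : SymmetricStrictMonoidalCategory o ℓ e) → Spatial (𝐇 (𝒞 𝔸))
lemma6p2 𝔸 X h = ≅⇒≈ (begin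
  castⱽ (V.identityˡ X) (V.identityˡ X) (h / 1ⱽ X)
    ≅⟨ castⱽ-≅ (V.identityˡ X) (V.identityˡ X) (h / 1ⱽ X) ⟩
  h / 1ⱽ X
    ≅⟨ Crossing.h/1≅1/h 𝔸 h X ⟩
  1ⱽ X / h
    ≅⟨ ≅-sym (castⱽ-≅ (V.identityʳ X) (V.identityʳ X) (1ⱽ X / h)) ⟩
  castⱽ (V.identityʳ X) (V.identityʳ X) (1ⱽ X / h)
    ∎)
  where
  open SingleObjectDoubleCategory (𝒞 𝔸)
  open HeterogeneousLaws (𝒞 𝔸)
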